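{- Let $n\ge 2$, $0<p<q$ be real numbers and let $A$ be the $n\times n$ matrix with columns $a_k=q e_k-p e_{k+1}$ ($1\le k\le n-1$) and $a_n=q e_n+p e_1$. Let $S=(s_{i,j})_{i,j=1}^n$ be a signed permutation matrix, i.e. $S\in\{0,\pm1\}^{n\times n}$ and every row and every column of $S$ contains exactly one nonzero entry. Then $S(A\mathbb{Z}^n)=A\mathbb{Z}^n$ if and only if all of the following hold: $s_{i,j}=s_{i+1,j+1}$ for all $i,j<n$; $s_{i,n}=-s_{i+1,1}$ and $s_{n,j}=-s_{1,j+1}$ for all $i,j<n$; and $s_{n,n}=s_{1,1}$.
   Context: $e_i$ denotes the $i$-th standard unit vector of $\mathbb{R}^n$. -}

module Defs where

open import Algebra.Bundles.Raw using (RawMonoid)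
open import Algebra.Definitions.RawMonoid using (sum)
open import Data.Fin.Base using (Fin; zero; suc; fromℕ; inject₁)
open import Data.Fin.Properties using (_≟_)
open import Data.Fin.Relation.Unary.Top using (view; ‵fromℕ; ‵inject₁)
open import Data.Integer.Base as ℤ using (ℤ; 0ℤ; 1ℤ; -1ℤ)
open import Data.Nat.Base as ℕ using (ℕ; suc)
import Data.Nat.Properties as ℕ
open import Data.Product using (∃; ∃-syntax; ∃!; _×_; _,_)
open import Data.Rational.Base as ℚ using (ℚ; 0ℚ; 1ℚ; ½)
import Data.Rational.Literals as ℚ
import Data.Rational.Properties as ℚ
open import Data.Rational.Solver using (module +-*-Solver)
open import Data.Sum.Base using (_⊎_)
open import Data.Vec.Functional using (Vector; map)
open import Data.Vec.Functional.Relation.Binary.Pointwise using (Pointwise)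
open import Level using (0ℓ)
open import Relation.Binary.Core using (Rel)
open import Relation.Binary.PropositionalEquality
open import Relation.Nullary.Decidable using (yes; no)
open import Relation.Unary using (Pred)

Eventually : Pred ℕ 0ℓ → Set
Eventually P = ∃[ N ] ∀ n → N ℕ.≤ n → P n

IsCauchy : (ℕ → ℚ) → Set
IsCauchy x = ∀ ε → 0ℚ ℚ.< ε →
  ∃[ N ] ∀ m n → N ℕ.≤ m → N ℕ.≤ n → ℚ.∣ x m ℚ.- x n ∣ ℚ.< ε

-- Equality of reals is the setoid equality _≃_ below, not _≡_.
record ℝ : Set where
  constructor mkℝ
  field
    seq    : ℕ → ℚ
    cauchy : IsCauchy seq

open ℝ public

infix 4 _≃_ _<_

_≃_ : Rel ℝ 0ℓ
x ≃ y = ∀ ε → 0ℚ ℚ.< ε → Eventually λ n → ℚ.∣ seq x n ℚ.- seq y n ∣ ℚ.< ε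

-- The gap ε is independent of n, so the limits differ strictly.
_<_ : Rel ℝ 0ℓ
x < y = ∃[ ε ] 0ℚ ℚ.< ε × Eventually λ n → seq x n ℚ.+ ε ℚ.< seq y n

half-pos : ∀ {ε} → 0ℚ ℚ.< ε → 0ℚ ℚ.< ½ ℚ.* ε
half-pos {ε} 0<ε =
  ℚ.positive⁻¹ (½ ℚ.* ε) {{ℚ.pos*pos⇒pos ½ ε {{ℚ.positive 0<ε}}}}

half+half : ∀ ε → ½ ℚ.* ε ℚ.+ ½ ℚ.* ε ≡ ε
half+half ε = trans (sym (ℚ.*-distribʳ-+ ε ½ ½)) (ℚ.*-identityˡ ε)

const-cauchy : ∀ a → IsCauchy (λ _ → a)
const-cauchy a ε 0<ε = 0 , λ _ _ _ _ →
  subst (ℚ._< ε) (cong ℚ.∣_∣ (sym (ℚ.+-inverseʳ a))) 0<ε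

neg-cauchy : ∀ {x} → IsCauchy x → IsCauchy (λ n → ℚ.- x n)
neg-cauchy {x} cx ε 0<ε with cx ε 0<ε
... | N , h = N , λ m n N≤m N≤n → subst (ℚ._< ε) (eq (x m) (x n)) (h m n N≤m N≤n)
  where
  open +-*-Solver
  eq : ∀ a b → ℚ.∣ a ℚ.- b ∣ ≡ ℚ.∣ (ℚ.- a) ℚ.- (ℚ.- b) ∣
  eq a b = trans (sym (ℚ.∣-p∣≡∣p∣ (a ℚ.- b)))
    (cong ℚ.∣_∣ (solve 2 (λ a b → :- (a :- b) := :- a :- :- b) refl a b))

∣a+b∣<ε : ∀ {ε} a b → ℚ.∣ a ∣ ℚ.< ½ ℚ.* ε → ℚ.∣ b ∣ ℚ.< ½ ℚ.* ε → ℚ.∣ a ℚ.+ b ∣ ℚ.< ε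
∣a+b∣<ε {ε} a b a< b< = ℚ.≤-<-trans (ℚ.∣p+q∣≤∣p∣+∣q∣ a b)
  (subst (ℚ.∣ a ∣ ℚ.+ ℚ.∣ b ∣ ℚ.<_) (half+half ε) (ℚ.+-mono-< a< b<))

+-cauchy : ∀ {x y} → IsCauchy x → IsCauchy y → IsCauchy (λ n → x n ℚ.+ y n)
+-cauchy {x} {y} cx cy ε 0<ε
  with cx (½ ℚ.* ε) (half-pos 0<ε) | cy (½ ℚ.* ε) (half-pos 0<ε)
... | M , f | N , g = M ℕ.⊔ N , λ m n M⊔N≤m M⊔N≤n →
  subst (λ a → ℚ.∣ a ∣ ℚ.< ε) (eq (x m) (x n) (y m) (y n))
    (∣a+b∣<ε (x m ℚ.- x n) (y m ℚ.- y n)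
      (f m n (ℕ.m⊔n≤o⇒m≤o M N M⊔N≤m) (ℕ.m⊔n≤o⇒m≤o M N M⊔N≤n))
      (g m n (ℕ.m⊔n≤o⇒n≤o M N M⊔N≤m) (ℕ.m⊔n≤o⇒n≤o M N M⊔N≤n)))
  where
  open +-*-Solver
  eq : ∀ a b c d → (a ℚ.- b) ℚ.+ (c ℚ.- d) ≡ (a ℚ.+ c) ℚ.- (b ℚ.+ d)
  eq = solve 4 (λ a b c d → (a :- b) :+ (c :- d) := (a :+ c) :- (b :+ d)) refl

cauchy⇒bounded : ∀ {x} → IsCauchy x →
  ∃[ B ] 0ℚ ℚ.< B × Eventually λ n → ℚ.∣ x n ∣ ℚ.< B
cauchy⇒bounded {x} cx with cx 1ℚ (ℚ.positive⁻¹ 1ℚ)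
... | N , h = 1ℚ ℚ.+ ℚ.∣ x N ∣ , 0<B , N , λ n N≤n →
  subst (λ a → ℚ.∣ a ∣ ℚ.< 1ℚ ℚ.+ ℚ.∣ x N ∣) (eq (x n) (x N))
    (ℚ.≤-<-trans (ℚ.∣p+q∣≤∣p∣+∣q∣ (x n ℚ.- x N) (x N))
      (ℚ.+-monoˡ-< ℚ.∣ x N ∣ (h n N N≤n ℕ.≤-refl)))
  where
  open +-*-Solver
  eq : ∀ a b → (a ℚ.- b) ℚ.+ b ≡ a
  eq = solve 2 (λ a b → (a :- b) :+ b := a) refl
  0<B : 0ℚ ℚ.< 1ℚ ℚ.+ ℚ.∣ x N ∣
  0<B = ℚ.+-mono-<-≤ (ℚ.positive⁻¹ 1ℚ) (ℚ.0≤∣p∣ (x N))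

bounded*small : ∀ B → 0ℚ ℚ.< B → ∀ ε → 0ℚ ℚ.< ε →
  ∃[ δ ] 0ℚ ℚ.< δ × (∀ a b → ℚ.∣ a ∣ ℚ.< B → ℚ.∣ b ∣ ℚ.< δ → ℚ.∣ a ℚ.* b ∣ ℚ.< ε)
bounded*small B 0<B ε 0<ε = δ , 0<δ , bound
  where
  instance
    B-pos : ℚ.Positive B
    B-pos = ℚ.positive 0<B
    ε-pos : ℚ.Positive ε
    ε-pos = ℚ.positive 0<ε
    B-nonZero : ℚ.NonZero B
    B-nonZero = ℚ.pos⇒nonZero B
  δ : ℚ
  δ = ℚ.1/ B ℚ.* ε
  0<δ : 0ℚ ℚ.< δ
  0<δ = ℚ.positive⁻¹ δ {{ℚ.pos*pos⇒pos (ℚ.1/ B) {{ℚ.1/pos⇒pos B}} ε}}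
  Bδ≡ε : B ℚ.* δ ≡ ε
  Bδ≡ε = trans (sym (ℚ.*-assoc B (ℚ.1/ B) ε))
    (trans (cong (ℚ._* ε) (ℚ.*-inverseʳ B)) (ℚ.*-identityˡ ε))
  bound : ∀ a b → ℚ.∣ a ∣ ℚ.< B → ℚ.∣ b ∣ ℚ.< δ → ℚ.∣ a ℚ.* b ∣ ℚ.< ε
  bound a b a<B b<δ = subst₂ ℚ._<_ (sym (ℚ.∣p*q∣≡∣p∣*∣q∣ a b)) Bδ≡ε
    (ℚ.≤-<-trans
      (ℚ.*-monoʳ-≤-nonNeg ℚ.∣ b ∣ {{ℚ.∣-∣-nonNeg b}} (ℚ.<⇒≤ a<B))
      (ℚ.*-monoʳ-<-pos B b<δ))

*-cauchy : ∀ {x y} → IsCauchy x → IsCauchy y → IsCauchy (λ n → x n ℚ.* y n)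
*-cauchy {x} {y} cx cy ε 0<ε =
  let B , 0<B , K , x<B = cauchy⇒bounded cx
      C , 0<C , L , y<C = cauchy⇒bounded cy
      δ , 0<δ , Bδ = bounded*small B 0<B (½ ℚ.* ε) (half-pos 0<ε)
      η , 0<η , Cη = bounded*small C 0<C (½ ℚ.* ε) (half-pos 0<ε)
      M , g = cy δ 0<δ
      N , f = cx η 0<η
  in (K ℕ.⊔ L) ℕ.⊔ (M ℕ.⊔ N) , λ m n ≤m ≤n →
  let KL≤m = ℕ.m⊔n≤o⇒m≤o (K ℕ.⊔ L) (M ℕ.⊔ N) ≤m
      MN≤m = ℕ.m⊔n≤o⇒n≤o (K ℕ.⊔ L) (M ℕ.⊔ N) ≤m
      KL≤n = ℕ.m⊔n≤o⇒m≤o (K ℕ.⊔ L) (M ℕ.⊔ N) ≤n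
      MN≤n = ℕ.m⊔n≤o⇒n≤o (K ℕ.⊔ L) (M ℕ.⊔ N) ≤n
  in subst (λ a → ℚ.∣ a ∣ ℚ.< ε) (eq (x m) (x n) (y m) (y n))
    (∣a+b∣<ε (x m ℚ.* (y m ℚ.- y n)) (y n ℚ.* (x m ℚ.- x n))
      (Bδ (x m) (y m ℚ.- y n) (x<B m (ℕ.m⊔n≤o⇒m≤o K L KL≤m))
        (g m n (ℕ.m⊔n≤o⇒m≤o M N MN≤m) (ℕ.m⊔n≤o⇒m≤o M N MN≤n)))
      (Cη (y n) (x m ℚ.- x n) (y<C n (ℕ.m⊔n≤o⇒n≤o K L KL≤n))
        (f m n (ℕ.m⊔n≤o⇒n≤o M N MN≤m) (ℕ.m⊔n≤o⇒n≤o M N MN≤n))))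
  where
  open +-*-Solver
  eq : ∀ a b c d → a ℚ.* (c ℚ.- d) ℚ.+ d ℚ.* (a ℚ.- b) ≡ (a ℚ.* c) ℚ.- (b ℚ.* d)
  eq = solve 4 (λ a b c d → a :* (c :- d) :+ d :* (a :- b) := a :* c :- b :* d) refl

infix  8 -_
infixl 7 _*_
infixl 6 _+_ _-_

_+_ _*_ : ℝ → ℝ → ℝ
x + y = mkℝ (λ n → seq x n ℚ.+ seq y n) (+-cauchy {seq x} {seq y} (cauchy x) (cauchy y))
x * y = mkℝ (λ n → seq x n ℚ.* seq y n) (*-cauchy {seq x} {seq y} (cauchy x) (cauchy y))

-_ : ℝ → ℝ
- x = mkℝ (λ n → ℚ.- seq x n) (neg-cauchy {seq x} (cauchy x))

_-_ : ℝ → ℝ → ℝ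
x - y = x + (- y)

fromℤ : ℤ → ℝ
fromℤ z = mkℝ (λ _ → ℚ.fromℤ z) (const-cauchy (ℚ.fromℤ z))

0ℝ 1ℝ : ℝ
0ℝ = fromℤ 0ℤ
1ℝ = fromℤ 1ℤ

+-rawMonoid : RawMonoid 0ℓ 0ℓ
+-rawMonoid = record { Carrier = ℝ ; _≈_ = _≃_ ; _∙_ = _+_ ; ε = 0ℝ }

Matrix : Set → ℕ → ℕ → Set
Matrix X m n = Fin m → Fin n → X

infix 4 _≋_

_≋_ : ∀ {n} → Rel (Vector ℝ n) 0ℓ
_≋_ = Pointwise _≃_

infixr 7 _*ᵥ_

_*ᵥ_ : ∀ {m n} → Matrix ℝ m n → Vector ℝ n → Vector ℝ m
(M *ᵥ v) i = sum +-rawMonoid λ j → M i j * v j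

fromℤᵐ : ∀ {m n} → Matrix ℤ m n → Matrix ℝ m n
fromℤᵐ M i j = fromℤ (M i j)

-- image M P is the set M P; lattice M is the set M ℤⁿ.  Both are closed
-- under _≋_.
image : ∀ {m n} → Matrix ℝ m n → Pred (Vector ℝ n) 0ℓ → Pred (Vector ℝ m) 0ℓ
image M P v = ∃[ w ] P w × v ≋ M *ᵥ w

lattice : ∀ {m n} → Matrix ℝ m n → Pred (Vector ℝ m) 0ℓ
lattice {n = n} M v = ∃ λ (z : Vector ℤ n) → v ≋ M *ᵥ map fromℤ z

e : ∀ {n} → Fin n → Vector ℝ n
e i j with i ≟ j
... | yes _ = 1ℝ
... | no  _ = 0ℝ

-- With n = suc m, the 1-based index k ≤ n - 1 is inject₁ k for k : Fin m,
-- its successor k + 1 is suc k, the index 1 is zero and n is fromℕ m.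
column : ∀ {m} → ℝ → ℝ → Fin (suc m) → Vector ℝ (suc m)
column {m} p q k i with view k
... | ‵inject₁ j = q * e (inject₁ j) i - p * e (suc j) i
... | ‵fromℕ     = q * e (fromℕ m) i + p * e zero i

A : ∀ {m} → ℝ → ℝ → Matrix ℝ (suc m) (suc m)
A p q i k = column p q k i

record IsSignedPermutation {n} (S : Matrix ℤ n n) : Set where
  field
    entries : ∀ i j → S i j ≡ 0ℤ ⊎ S i j ≡ 1ℤ ⊎ S i j ≡ -1ℤ
    rows    : ∀ i → ∃! _≡_ λ j → S i j ≢ 0ℤ
    columns : ∀ j → ∃! _≡_ λ i → S i j ≢ 0ℤ

{-# OPTIONS --safe #-}
module Submission where

open import Algebra.Definitions.RawMonoid using (sum)
open import Data.Fin.Base using (Fin; zero; suc; fromℕ; inject₁; toℕ)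
open import Data.Fin.Induction using (<-weakInduction)
import Data.Fin.Properties as Fin
open import Data.Fin.Relation.Unary.Top using (view; view-inject₁; view-fromℕ; ‵fromℕ; ‵inject₁)
open import Data.Integer.Base as ℤ using (ℤ; 0ℤ)
import Data.Integer.Properties as ℤ
import Data.Integer.Solver as ℤ
open import Data.Nat.Base as ℕ using (ℕ; suc; z≤n; z<s)
import Data.Nat.Properties as ℕ
open import Data.Product using (_×_; _,_; ∃!)
open import Data.Rational.Base as ℚ using (ℚ; 0ℚ; ½)
import Data.Rational.Literals as ℚ
import Data.Rational.Properties as ℚ
open import Data.Rational.Solver using (module +-*-Solver)
import Data.Rational.Unnormalised.Base as ℚᵘ
import Data.Rational.Unnormalised.Properties as ℚᵘ
open import Data.Sum.Base using (_⊎_; inj₁; inj₂)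
open import Data.Vec.Functional using (Vector; map)
open import Function.Bundles using (_⇔_; mk⇔)
open import Level using (0ℓ)
open import Relation.Binary.Core using (Rel)
open import Relation.Binary.Definitions using (Reflexive; Transitive; tri<; tri≈; tri>)
open import Relation.Binary.PropositionalEquality
open import Relation.Nullary using (yes; no; ¬_; ¬?; _×-dec_; contradiction)
open import Relation.Unary using (Pred; _⊆_; _≐_)

-- Let R be the negacyclic shift, R eₖ = eₖ₊₁ and R eₙ = - e₁.  Then A = q I - p R, and
-- the entrywise conditions say S R = R S.  If S commutes with R then it commutes with A,
-- and it permutes ℤⁿ.
--
-- Conversely write S A eₖ = A z with z integral, and put x = S eₖ - z and
-- w = S R eₖ - R S eₖ, so that q x = p (R x + w).  As 0 < p < q, in each coordinate
-- i either xᵢ and (R x + w)ᵢ vanish or they have the same sign and ∣xᵢ∣ < ∣(R x + w)ᵢ∣.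
-- Now w is a difference of two signed unit vectors.  If their supports differ, all
-- ∣wᵢ∣ ≤ 1, hence xᵢ lies between 0 and (R x)ᵢ; going once around the cycle, where R
-- flips the sign, xᵢ lies between 0 and - xᵢ, so x = 0 and then w = 0.  If their supports
-- agree, w lives in one coordinate i and ∣wᵢ∣ ≤ 2; signs propagate around the cycle from i,
-- so (R x)ᵢ has the sign of - xᵢ, which leaves no room for xᵢ ≠ 0, and again w = 0.

module NegacyclicShift where
  open import Algebra.Properties.Semiring.Sum ℤ.+-*-semiring using (sum-cong-≗; sum-init-last; *-distribˡ-sum)
  open import Data.Integer.Base hiding (suc; pos; neg)
  open import Data.Integer.Properties
  open import Defs using (Matrix; IsSignedPermutation)

  -- The negacyclic shift and walks around its cycle.

  rot : ∀ {m} → Vector ℤ (suc m) → Vector ℤ (suc m)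
  rot {m} z zero    = - z (fromℕ m)
  rot     z (suc i) = z (inject₁ i)

  -- Follow x from i up to the last coordinate, wrap around with a sign change, and go on
  -- up to the predecessor of i.
  rot-around : ∀ {m} (_~_ : Rel ℤ 0ℓ) → Reflexive _~_ → Transitive _~_ →
    (∀ {a b} → a ~ b → (- a) ~ (- b)) →
    ∀ (x : Vector ℤ (suc m)) i → (∀ j → j ≢ i → x j ~ rot x j) → rot x i ~ (- x i)
  rot-around {m} _~_ ~-refl ~-trans ~-neg x i step = close i refl
    where
    -- The induction runs upward from `zero`, not from `i`, so the walk is cut in two: coordinates
    -- below `i` are linked to `x zero`, those from `i` on to `x i`. `close` joins the pieces at the
    -- wrap.
    Reached : Fin (suc m) → Set
    Reached j = (toℕ j ℕ.< toℕ i × x j ~ x zero) ⊎ (toℕ i ℕ.≤ toℕ j × x j ~ x i)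

    start : ∀ k → k ≡ i → Reached zero
    start zero    refl = inj₂ (z≤n , ~-refl)
    start (suc _) refl = inj₁ (z<s , ~-refl)

    next : ∀ j → Reached (inject₁ j) → Reached (suc j)
    next j r with suc j Fin.≟ i
    next j _ | yes refl = inj₂ (ℕ.≤-refl , ~-refl)
    next j (inj₁ (j<i , xj~x0)) | no j+1≢i = inj₁
      ( ℕ.≤∧≢⇒< (subst (ℕ._< toℕ i) (Fin.toℕ-inject₁ j) j<i) (λ eq → j+1≢i (Fin.toℕ-injective eq))
      , ~-trans (step (suc j) j+1≢i) xj~x0)
    next j (inj₂ (i≤j , xj~xi)) | no j+1≢i = inj₂
      ( ℕ.m≤n⇒m≤1+n (subst (toℕ i ℕ.≤_) (Fin.toℕ-inject₁ j) i≤j)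
      , ~-trans (step (suc j) j+1≢i) xj~xi)

    reached : ∀ j → Reached j
    reached = <-weakInduction Reached (start i refl) next

    last~i : x (fromℕ m) ~ x i
    last~i with reached (fromℕ m)
    ... | inj₂ (_ , xm~xi) = xm~xi
    ... | inj₁ (m<i , _)   = contradiction (Fin.≤fromℕ i) (ℕ.<⇒≱ m<i)

    close : ∀ k → k ≡ i → rot x k ~ (- x k)
    close zero    refl = ~-neg last~i
    close (suc k) refl with reached (inject₁ k)
    -- The step at `zero` crosses the wrap, since `rot x zero` is minus the last coordinate, and the
    -- last coordinate is linked to `x i`.
    ... | inj₁ (_ , xk~x0) = ~-trans xk~x0 (~-trans (step zero λ ()) (~-neg last~i))
    ... | inj₂ (k<k , _)   =
      contradiction (subst (suc (toℕ k) ℕ.≤_) (Fin.toℕ-inject₁ k) k<k) (ℕ.<-irrefl refl)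

  -- Sign and order relations between integers.

  infix 4 _◁_ _⊑_ _∼_

  -- What q a = p b with 0 < p < q says about integers a and b.
  data _◁_ (a b : ℤ) : Set where
    zer : a ≡ 0ℤ → b ≡ 0ℤ → a ◁ b
    pos : 0ℤ < a → a < b → a ◁ b
    neg : b < a → a < 0ℤ → a ◁ b

  -- a lies between 0 and b.
  _⊑_ : Rel ℤ 0ℓ
  a ⊑ b = (0ℤ ≤ a × a ≤ b) ⊎ (b ≤ a × a ≤ 0ℤ)

  data _∼_ (a b : ℤ) : Set where
    zer : a ≡ 0ℤ → b ≡ 0ℤ → a ∼ b
    pos : 0ℤ < a → 0ℤ < b → a ∼ b
    neg : a < 0ℤ → b < 0ℤ → a ∼ b

  ⊑-refl : Reflexive _⊑_
  ⊑-refl {a} with ≤-total 0ℤ a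
  ... | inj₁ 0≤a = inj₁ (0≤a , ≤-refl)
  ... | inj₂ a≤0 = inj₂ (≤-refl , a≤0)

  ⊑-trans : Transitive _⊑_
  ⊑-trans (inj₁ (0≤a , a≤b)) (inj₁ (_ , b≤c))   = inj₁ (0≤a , ≤-trans a≤b b≤c)
  -- Opposite orientations force b = 0 and hence a = 0; the result takes the orientation of the
  -- second argument.
  ⊑-trans (inj₁ (0≤a , a≤b)) (inj₂ (c≤b , b≤0)) =
    inj₂ (≤-trans c≤b (≤-trans b≤0 0≤a) , ≤-trans a≤b b≤0)
  ⊑-trans (inj₂ (b≤a , a≤0)) (inj₁ (0≤b , b≤c)) =
    inj₁ (≤-trans 0≤b b≤a , ≤-trans a≤0 (≤-trans 0≤b b≤c))
  ⊑-trans (inj₂ (b≤a , a≤0)) (inj₂ (c≤b , _))   = inj₂ (≤-trans c≤b b≤a , a≤0)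

  ⊑-neg : ∀ {a b} → a ⊑ b → - a ⊑ - b
  ⊑-neg (inj₁ (0≤a , a≤b)) = inj₂ (neg-mono-≤ a≤b , neg-mono-≤ 0≤a)
  ⊑-neg (inj₂ (b≤a , a≤0)) = inj₁ (neg-mono-≤ a≤0 , neg-mono-≤ b≤a)

  ⊑-antisym-neg : ∀ {a} → a ⊑ - a → a ≡ 0ℤ
  ⊑-antisym-neg {a} (inj₁ (0≤a , a≤-a)) = ≤-antisym (≤-trans a≤-a (neg-mono-≤ 0≤a)) 0≤a
  ⊑-antisym-neg {a} (inj₂ (-a≤a , a≤0)) = ≤-antisym a≤0 (≤-trans (neg-mono-≤ a≤0) -a≤a)

  ∼-refl : Reflexive _∼_
  ∼-refl {+0}       = zer refl refl
  ∼-refl {+[1+ n ]} = pos (+<+ z<s) (+<+ z<s)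
  ∼-refl { -[1+ n ]} = neg -<+ -<+

  ∼-trans : Transitive _∼_
  ∼-trans (zer a≡0 _)    (zer _ c≡0) = zer a≡0 c≡0
  ∼-trans (pos 0<a _)    (pos _ 0<c) = pos 0<a 0<c
  ∼-trans (neg a<0 _)    (neg _ c<0) = neg a<0 c<0
  ∼-trans (zer _ refl)   (pos 0<0 _) = contradiction 0<0 i≮i
  ∼-trans (zer _ refl)   (neg 0<0 _) = contradiction 0<0 i≮i
  ∼-trans (pos _ 0<0)    (zer refl _) = contradiction 0<0 i≮i
  ∼-trans (neg _ 0<0)    (zer refl _) = contradiction 0<0 i≮i
  ∼-trans (pos _ 0<b)    (neg b<0 _) = contradiction (<-trans 0<b b<0) i≮i
  ∼-trans (neg _ b<0)    (pos 0<b _) = contradiction (<-trans 0<b b<0) i≮i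

  ∼-neg : ∀ {a b} → a ∼ b → - a ∼ - b
  ∼-neg (zer refl refl) = zer refl refl
  ∼-neg (pos 0<a 0<b)   = neg (neg-mono-< 0<a) (neg-mono-< 0<b)
  ∼-neg (neg a<0 b<0)   = pos (neg-mono-< a<0) (neg-mono-< b<0)

  ◁⇒∼ : ∀ {a b} → a ◁ b → a ∼ b
  ◁⇒∼ (zer a≡0 b≡0) = zer a≡0 b≡0
  ◁⇒∼ (pos 0<a a<b) = pos 0<a (<-trans 0<a a<b)
  ◁⇒∼ (neg b<a a<0) = neg a<0 (<-trans b<a a<0)

  Bounded : ℤ → ℤ → Set
  Bounded c w = - c ≤ w × w ≤ c

  -- Strictness between integers gains 1, which pays for w: from 0 < a < b + w and w ≤ 1 follows a ≤
  -- b, and dually for negative a. If a = 0, it lies between 0 and anything.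
  ◁⇒⊑ : ∀ {a b w} → Bounded 1ℤ w → a ◁ b + w → a ⊑ b
  ◁⇒⊑ {b = b} _ (zer refl _) with ≤-total 0ℤ b
  ... | inj₁ 0≤b = inj₁ (≤-refl , 0≤b)
  ... | inj₂ b≤0 = inj₂ (b≤0 , ≤-refl)
  ◁⇒⊑ {a} {b} (_ , w≤1) (pos 0<a a<b+w) = inj₁ (<⇒≤ 0<a ,
    subst (a ≤_) (solve 1 (λ b → con -1ℤ :+ (b :+ con 1ℤ) := b) refl b)
      (i<j⇒i≤pred[j] (<-≤-trans a<b+w (+-monoʳ-≤ b w≤1))))
    where open ℤ.+-*-Solver
  ◁⇒⊑ {a} {b} (-1≤w , _) (neg b+w<a a<0) = inj₂ (
    subst (_≤ a) (solve 1 (λ b → con 1ℤ :+ (b :+ con -1ℤ) := b) refl b)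
      (i<j⇒suc[i]≤j (≤-<-trans (+-monoʳ-≤ b -1≤w) b+w<a)) , <⇒≤ a<0)
    where open ℤ.+-*-Solver

  ∼0⇒≡0 : ∀ {a} → a ∼ 0ℤ → a ≡ 0ℤ
  ∼0⇒≡0 (zer a≡0 _) = a≡0
  ∼0⇒≡0 (pos _ 0<0) = contradiction 0<0 i≮i
  ∼0⇒≡0 (neg _ 0<0) = contradiction 0<0 i≮i

  -- If a > 0 then b ≤ -1, so b + w ≤ 1, while b + w > a ≥ 1; negative a is symmetric. Hence a = 0,
  -- which gives b = 0 and b + w = 0.
  ◁-opposite : ∀ {a b w} → Bounded (+ 2) w → b ∼ - a → a ◁ b + w → w ≡ 0ℤ
  ◁-opposite {b = b} {w} _ b∼-a (zer refl b+w≡0) =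
    trans (sym (+-identityˡ w)) (trans (cong (_+ w) (sym (∼0⇒≡0 b∼-a))) b+w≡0)
  ◁-opposite {a} {b} (_ , w≤2) b∼-a (pos 0<a a<b+w) = contradiction
    (≤-trans (i<j⇒suc[i]≤j 0<a) (i<j⇒i≤pred[j] (<-≤-trans a<b+w (+-mono-≤ (b≤-1 b∼-a) w≤2))))
    λ { (+≤+ ()) }
    where
    -a<0 : - a < 0ℤ
    -a<0 = neg-mono-< 0<a
    b≤-1 : b ∼ - a → b ≤ -1ℤ
    b≤-1 (zer _ -a≡0) = contradiction (subst (_< 0ℤ) -a≡0 -a<0) i≮i
    b≤-1 (pos _ 0<-a) = contradiction (<-trans 0<-a -a<0) i≮i
    b≤-1 (neg b<0 _)  = i<j⇒i≤pred[j] b<0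
  ◁-opposite {a} {b} (-2≤w , _) b∼-a (neg b+w<a a<0) = contradiction
    (≤-trans (i<j⇒suc[i]≤j (≤-<-trans (+-mono-≤ (1≤b b∼-a) -2≤w) b+w<a)) (i<j⇒i≤pred[j] a<0))
    λ ()
    where
    0<-a : 0ℤ < - a
    0<-a = neg-mono-< a<0
    1≤b : b ∼ - a → 1ℤ ≤ b
    1≤b (zer _ -a≡0) = contradiction (subst (0ℤ <_) -a≡0 0<-a) i≮i
    1≤b (pos 0<b _)  = i<j⇒suc[i]≤j 0<b
    1≤b (neg _ -a<0) = contradiction (<-trans 0<-a -a<0) i≮i

  -- The two cases in which the perturbation w must vanish.

  module _ {m} {x w : Vector ℤ (suc m)} (x◁ : ∀ i → x i ◁ rot x i + w i) where

    -- Each `x j` lies between 0 and `rot x j`, which after one turn lies between 0 and `- x j`. So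
    -- x = 0, and `x◁` then leaves only its zero case.
    spread⇒zero : (∀ i → Bounded 1ℤ (w i)) → ∀ i → w i ≡ 0ℤ
    spread⇒zero w≤1 i = trans (sym (+-identityˡ (w i)))
      (trans (cong (_+ w i) (sym (rot≡0 i))) (y≡0 (x◁ i)))
      where
      x⊑ : ∀ j → x j ⊑ rot x j
      x⊑ j = ◁⇒⊑ (w≤1 j) (x◁ j)
      x≡0 : ∀ j → x j ≡ 0ℤ
      x≡0 j = ⊑-antisym-neg (⊑-trans (x⊑ j)
        (rot-around _⊑_ ⊑-refl ⊑-trans ⊑-neg x j (λ k _ → x⊑ k)))
      rot≡0 : ∀ j → rot x j ≡ 0ℤ
      rot≡0 zero    = cong -_ (x≡0 (fromℕ m))
      rot≡0 (suc j) = x≡0 (inject₁ j)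
      y≡0 : x i ◁ rot x i + w i → rot x i + w i ≡ 0ℤ
      y≡0 (zer _ y≡0) = y≡0
      y≡0 (pos 0<x _) = contradiction (subst (0ℤ <_) (x≡0 i) 0<x) i≮i
      y≡0 (neg _ x<0) = contradiction (subst (_< 0ℤ) (x≡0 i) x<0) i≮i

    -- Away from `i` the perturbation is absent, so signs pass unchanged from each coordinate to the
    -- next, and `rot x i` has the sign of `- x i`.
    concentrated⇒zero : ∀ i → Bounded (+ 2) (w i) → (∀ j → j ≢ i → w j ≡ 0ℤ) → w i ≡ 0ℤ
    concentrated⇒zero i w≤2 w≡0 = ◁-opposite w≤2
      (rot-around _∼_ ∼-refl ∼-trans ∼-neg x i λ j j≢i → ◁⇒∼
        (subst (x j ◁_) (trans (cong (λ t → rot x j + t) (w≡0 j j≢i)) (+-identityʳ (rot x j))) (x◁ j)))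
      (x◁ i)

  -- Signed unit vectors.

  SignUnit : ℤ → Set
  SignUnit a = a ≡ 0ℤ ⊎ a ≡ 1ℤ ⊎ a ≡ -1ℤ

  SignUnit-neg : ∀ {a} → SignUnit a → SignUnit (- a)
  SignUnit-neg (inj₁ refl)        = inj₁ refl
  SignUnit-neg (inj₂ (inj₁ refl)) = inj₂ (inj₂ refl)
  SignUnit-neg (inj₂ (inj₂ refl)) = inj₂ (inj₁ refl)

  SignUnit-square : ∀ {a} → SignUnit a → a ≢ 0ℤ → a * a ≡ 1ℤ
  SignUnit-square (inj₁ refl)        0≢0 = contradiction refl 0≢0
  SignUnit-square (inj₂ (inj₁ refl)) _   = refl
  SignUnit-square (inj₂ (inj₂ refl)) _   = refl

  SignUnit⇒Bounded : ∀ {a} → SignUnit a → Bounded 1ℤ a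
  SignUnit⇒Bounded (inj₁ refl)        = -≤+ , +≤+ z≤n
  SignUnit⇒Bounded (inj₂ (inj₁ refl)) = -≤+ , ≤-refl
  SignUnit⇒Bounded (inj₂ (inj₂ refl)) = ≤-refl , -≤+

  -- The condition is "at most one nonzero entry, equal to 1 or -1"; the zero vector satisfies it
  -- too.
  record IsSignedUnitVector {n} (u : Vector ℤ n) : Set where
    field
      entry  : ∀ i → SignUnit (u i)
      unique : ∀ {i j} → u i ≢ 0ℤ → u j ≢ 0ℤ → i ≡ j

    zeroElsewhere : ∀ {i} → u i ≢ 0ℤ → ∀ j → j ≢ i → u j ≡ 0ℤ
    zeroElsewhere ui≢0 j j≢i with u j ≟ 0ℤ
    ... | yes uj≡0 = uj≡0
    ... | no  uj≢0 = contradiction (unique uj≢0 ui≢0) j≢i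

  open IsSignedUnitVector

  neg-≢0 : ∀ {a} → - a ≢ 0ℤ → a ≢ 0ℤ
  neg-≢0 -a≢0 refl = -a≢0 refl

  neg-signedUnit : ∀ {n} {u : Vector ℤ n} → IsSignedUnitVector u → IsSignedUnitVector (λ i → - u i)
  neg-signedUnit U .entry i              = SignUnit-neg (U .entry i)
  neg-signedUnit U .unique -ui≢0 -uj≢0 = U .unique (neg-≢0 -ui≢0) (neg-≢0 -uj≢0)

  rot-signedUnit : ∀ {m} {u : Vector ℤ (suc m)} → IsSignedUnitVector u → IsSignedUnitVector (rot u)
  rot-signedUnit U .entry zero    = SignUnit-neg (U .entry _)
  rot-signedUnit U .entry (suc i) = U .entry _
  rot-signedUnit U .unique {zero}  {zero}  _ _ = refl
  rot-signedUnit U .unique {zero}  {suc j} h k = contradiction (U .unique (neg-≢0 h) k) Fin.fromℕ≢inject₁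
  rot-signedUnit U .unique {suc i} {zero}  h k = contradiction (U .unique (neg-≢0 k) h) Fin.fromℕ≢inject₁
  rot-signedUnit U .unique {suc i} {suc j} h k = cong suc (Fin.inject₁-injective (U .unique h k))

  module _ {m} {x u v : Vector ℤ (suc m)}
    (U : IsSignedUnitVector u) (V : IsSignedUnitVector v)
    (x◁ : ∀ i → x i ◁ rot x i + (v i - u i)) where

    -- Without a common nonzero coordinate, all entries of v - u have size at most 1. With a common
    -- one `k`, both vectors vanish off `k`, so v - u is concentrated there and has size at most 2.
    signedUnits-agree : ∀ i → v i ≡ u i
    signedUnits-agree i with Fin.any? (λ j → ¬? (u j ≟ 0ℤ) ×-dec ¬? (v j ≟ 0ℤ))
    ... | no disjoint = i-j≡0⇒i≡j (v i) (u i) (spread⇒zero x◁ bound i)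
      where
      bound : ∀ j → Bounded 1ℤ (v j - u j)
      bound j with u j in uj | v j in vj
      ... | a | b with a ≟ 0ℤ | b ≟ 0ℤ
      ... | yes refl | _ = subst (Bounded 1ℤ) (sym (+-identityʳ b))
        (SignUnit⇒Bounded (subst SignUnit vj (V .entry j)))
      ... | no a≢0 | yes refl = subst (Bounded 1ℤ) (sym (+-identityˡ (- a)))
        (SignUnit⇒Bounded (SignUnit-neg (subst SignUnit uj (U .entry j))))
      ... | no a≢0 | no b≢0 = contradiction
        (j , (λ eq → a≢0 (trans (sym uj) eq)) , (λ eq → b≢0 (trans (sym vj) eq))) disjoint
    ... | yes (k , uk≢0 , vk≢0) with i Fin.≟ k
    ... | no i≢k = trans (zeroElsewhere V vk≢0 i i≢k) (sym (zeroElsewhere U uk≢0 i i≢k))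
    ... | yes refl = i-j≡0⇒i≡j (v i) (u i) (concentrated⇒zero x◁ i
      (let -1≤v , v≤1 = SignUnit⇒Bounded (V .entry i)
           -1≤u , u≤1 = SignUnit⇒Bounded (U .entry i)
       in +-mono-≤ -1≤v (neg-mono-≤ u≤1) , +-mono-≤ v≤1 (neg-mono-≤ -1≤u))
      λ j j≢i → cong₂ _-_ (zeroElsewhere V vk≢0 j j≢i) (zeroElsewhere U uk≢0 j j≢i))

  -- Dot products and matrices commuting with the shift.

  -- The transpose of rot.
  unrot : ∀ {m} → Vector ℤ (suc m) → Vector ℤ (suc m)
  unrot s k with view k
  ... | ‵inject₁ j = s (suc j)
  ... | ‵fromℕ     = - s zero

  unrot-inject₁ : ∀ {m} (s : Vector ℤ (suc m)) j → unrot s (inject₁ j) ≡ s (suc j)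
  unrot-inject₁ s j rewrite view-inject₁ j = refl

  unrot-fromℕ : ∀ {m} (s : Vector ℤ (suc m)) → unrot s (fromℕ m) ≡ - s zero
  unrot-fromℕ {m} s rewrite view-fromℕ m = refl

  infix 8 _·_

  _·_ : ∀ {n} → Vector ℤ n → Vector ℤ n → ℤ
  s · z = sum +-0-rawMonoid λ j → s j * z j

  -- The wrapped term is first on the left and last on the right; moving it to the end, with its
  -- sign passed from z to s, aligns the two sums.
  ·-rot : ∀ {m} (s z : Vector ℤ (suc m)) → s · rot z ≡ unrot s · z
  ·-rot {m} s z = begin
    s zero * - z (fromℕ m) + sum +-0-rawMonoid tail
      ≡⟨ solve 3 (λ a b c → a :* :- b :+ c := c :+ :- a :* b) refl (s zero) (z (fromℕ m)) (sum +-0-rawMonoid tail) ⟩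
    sum +-0-rawMonoid tail + - s zero * z (fromℕ m)
      ≡⟨ cong₂ _+_ (sum-cong-≗ λ j → cong (_* z (inject₁ j)) (sym (unrot-inject₁ s j)))
           (cong (_* z (fromℕ m)) (sym (unrot-fromℕ s))) ⟩
    (sum +-0-rawMonoid λ j → unrot s (inject₁ j) * z (inject₁ j)) + unrot s (fromℕ m) * z (fromℕ m)
      ≡⟨ sum-init-last (λ k → unrot s k * z k) ⟨
    unrot s · z ∎
    where
    open ≡-Reasoning
    open ℤ.+-*-Solver
    tail : Vector ℤ m
    tail j = s (suc j) * z (inject₁ j)

  sum-zero : ∀ {n} (f : Vector ℤ n) → (∀ k → f k ≡ 0ℤ) → sum +-0-rawMonoid f ≡ 0ℤ
  sum-zero {ℕ.zero}  f f≡0 = refl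
  sum-zero {ℕ.suc n} f f≡0 = cong₂ _+_ (f≡0 zero) (sum-zero (λ k → f (suc k)) λ k → f≡0 (suc k))

  sum-single : ∀ {n} (f : Vector ℤ n) j → (∀ k → k ≢ j → f k ≡ 0ℤ) → sum +-0-rawMonoid f ≡ f j
  sum-single f zero    f≡0 = trans
    (cong (λ t → f zero + t) (sum-zero (λ k → f (suc k)) λ k → f≡0 (suc k) λ ()))
    (+-identityʳ (f zero))
  sum-single f (suc j) f≡0 = trans
    (cong₂ _+_ (f≡0 zero λ ())
      (sum-single (λ k → f (suc k)) j λ k k≢j → f≡0 (suc k) λ eq → k≢j (Fin.suc-injective eq)))
    (+-identityˡ (f (suc j)))

  δ : ∀ {n} → Fin n → Vector ℤ n
  δ i j with i Fin.≟ j
  ... | yes _ = 1ℤ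
  ... | no  _ = 0ℤ

  δ-diag : ∀ {n} (i : Fin n) → δ i i ≡ 1ℤ
  δ-diag i with i Fin.≟ i
  ... | yes _  = refl
  ... | no i≢i = contradiction refl i≢i

  δ-off : ∀ {n} {i j : Fin n} → i ≢ j → δ i j ≡ 0ℤ
  δ-off {i = i} {j} i≢j with i Fin.≟ j
  ... | yes i≡j = contradiction i≡j i≢j
  ... | no  _   = refl

  ·-δ : ∀ {n} (s : Vector ℤ n) k → s · δ k ≡ s k
  ·-δ s k = trans
    (sum-single _ k λ j j≢k → trans (cong (s j *_) (δ-off (≢-sym j≢k))) (*-zeroʳ (s j)))
    (trans (cong (s k *_) (δ-diag k)) (*-identityʳ (s k)))

  δ-· : ∀ {n} (z : Vector ℤ n) i → (λ k → δ k i) · z ≡ z i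
  δ-· z i = trans
    (sum-single _ i λ j j≢i → cong (_* z j) (δ-off j≢i))
    (trans (cong (_* z i) (δ-diag i)) (*-identityˡ (z i)))

  rot-cong : ∀ {m} {y z : Vector ℤ (suc m)} → y ≗ z → rot y ≗ rot z
  rot-cong y≗z zero    = cong -_ (y≗z _)
  rot-cong y≗z (suc i) = y≗z _

  rot-sub : ∀ {m} (y z : Vector ℤ (suc m)) i → rot (λ j → y j - z j) i ≡ rot y i - rot z i
  rot-sub y z zero    = neg-distrib-+ (y (fromℕ _)) (- z (fromℕ _))
  rot-sub y z (suc i) = refl

  -- The identity S R = R S entry by entry: row i of S R is `unrot (S i)`, and column k of R S is
  -- the shift of column k of S.
  RotCommutes : ∀ {m} → Matrix ℤ (suc m) (suc m) → Set
  RotCommutes S = ∀ i k → unrot (S i) k ≡ rot (λ l → S l k) i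

  Negacyclic : ∀ {m} → Matrix ℤ (suc m) (suc m) → Set
  Negacyclic {m} S =
      (∀ (i j : Fin m) → S (inject₁ i) (inject₁ j) ≡ S (suc i) (suc j))
    × (∀ (i : Fin m) → S (inject₁ i) (fromℕ m) ≡ - S (suc i) zero)
    × (∀ (j : Fin m) → S (fromℕ m) (inject₁ j) ≡ - S zero (suc j))
    × S (fromℕ m) (fromℕ m) ≡ S zero zero

  module _ {m} {S : Matrix ℤ (suc m) (suc m)} where

    -- From entries to vectors, S R z = R S z: transposition moves the shift onto row i, commutation
    -- rewrites that row, and in row `zero` the sign is pulled out of the sum.
    rotCommutes-· : RotCommutes S → ∀ z i → S i · rot z ≡ rot (λ l → S l · z) i
    rotCommutes-· comm z i = trans (·-rot (S i) z)
      (trans (sum-cong-≗ λ k → cong (_* z k) (comm i k)) (pull i))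
      where
      open ℤ.+-*-Solver
      pull : ∀ i → (λ k → rot (λ l → S l k) i) · z ≡ rot (λ l → S l · z) i
      pull (suc i) = refl
      pull zero    = trans
        (sum-cong-≗ λ k → solve 2 (λ a b → :- a :* b := con -1ℤ :* (a :* b)) refl (S (fromℕ m) k) (z k))
        (trans (sym (*-distribˡ-sum -1ℤ λ k → S (fromℕ m) k * z k)) (-1*i≡-i (S (fromℕ m) · z)))

    -- Splitting i into `zero` or a successor and k into an initial or the last index turns
    -- commutation into exactly the four families of equations.
    rotCommutes⇒negacyclic : RotCommutes S → Negacyclic S
    rotCommutes⇒negacyclic comm =
        (λ i j → trans (sym (comm (suc i) (inject₁ j))) (unrot-inject₁ (S (suc i)) j))
      , (λ i → trans (sym (comm (suc i) (fromℕ m))) (unrot-fromℕ (S (suc i))))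
      , (λ j → trans (sym (neg-involutive _))
          (cong -_ (trans (sym (comm zero (inject₁ j))) (unrot-inject₁ (S zero) j))))
      , neg-injective (trans (sym (comm zero (fromℕ m))) (unrot-fromℕ (S zero)))

    negacyclic⇒rotCommutes : Negacyclic S → RotCommutes S
    negacyclic⇒rotCommutes (inner , right , bottom , corner) i k with view k
    negacyclic⇒rotCommutes (inner , right , bottom , corner) zero    k | ‵inject₁ j =
      trans (sym (neg-involutive _)) (cong -_ (sym (bottom j)))
    negacyclic⇒rotCommutes (inner , right , bottom , corner) (suc i) k | ‵inject₁ j = sym (inner i j)
    negacyclic⇒rotCommutes (inner , right , bottom , corner) zero    k | ‵fromℕ     = cong -_ (sym corner)
    negacyclic⇒rotCommutes (inner , right , bottom , corner) (suc i) k | ‵fromℕ     = sym (right i)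

  -- Columns and inverse of a signed permutation matrix.

  module _ {n} {S : Matrix ℤ n n} (signed : IsSignedPermutation S) where
    open IsSignedPermutation signed

    column-signedUnit : ∀ k → IsSignedUnitVector (λ i → S i k)
    column-signedUnit k .entry i = entries i k
    column-signedUnit k .unique h h′ =
      let _ , _ , only = columns k in trans (sym (only h)) (only h′)

    -- The transpose of S applied to z, which is also the inverse of S applied to z; each column
    -- contributes its only nonzero entry.
    preimage : Vector ℤ n → Vector ℤ n
    preimage z j = let i , _ = columns j in S i j * z i

    ·-preimage : ∀ z i → S i · preimage z ≡ z i
    ·-preimage z i with rows i
    ... | j , Sij≢0 , only = trans (sum-single _ j vanish) (hit (columns j))
      where
      vanish : ∀ k → k ≢ j → S i k * preimage z k ≡ 0ℤ
      vanish k k≢j with S i k ≟ 0ℤ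
      ... | yes Sik≡0 = cong (_* preimage z k) Sik≡0
      ... | no  Sik≢0 = contradiction (sym (only Sik≢0)) k≢j
      -- The column witness is a variable `c` so that its row index `l` can be identified with `i`,
      -- after which the entry is squared to 1.
      hit : (c : ∃! _≡_ λ l → S l j ≢ 0ℤ) → let l , _ = c in S i j * (S l j * z l) ≡ z i
      hit (l , _ , only′) with only′ Sij≢0
      ... | refl = trans (sym (*-assoc (S i j) (S i j) (z i)))
        (trans (cong (_* z i) (SignUnit-square (entries i j) Sij≢0)) (*-identityˡ (z i)))

  -- These are the columns of S R, that is, columns of S up to sign.
  unrotColumn-signedUnit : ∀ {m} {S : Matrix ℤ (suc m) (suc m)} → IsSignedPermutation S →
    ∀ k → IsSignedUnitVector (λ i → unrot (S i) k)
  unrotColumn-signedUnit signed k with view k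
  ... | ‵inject₁ j = column-signedUnit signed (suc j)
  ... | ‵fromℕ     = neg-signedUnit (column-signedUnit signed zero)

open NegacyclicShift
open import Data.Nat.Base using (_≤_)
open import Defs

-- Embedding of the integers, congruences for the reals, and null sequences.

fromℤ-homo-+ : ∀ a b → ℚ.fromℤ (a ℤ.+ b) ≡ ℚ.fromℤ a ℚ.+ ℚ.fromℤ b
fromℤ-homo-+ a b = ℚ.toℚᵘ-injective (ℚᵘ.≃-trans
  (ℚᵘ.*≡* (solve 2 (λ a b → (a :+ b) :* con ℤ.1ℤ := (a :* con ℤ.1ℤ :+ b :* con ℤ.1ℤ) :* con ℤ.1ℤ) refl a b))
  (ℚᵘ.≃-sym (ℚ.toℚᵘ-homo-+ (ℚ.fromℤ a) (ℚ.fromℤ b))))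
  where open ℤ.+-*-Solver

fromℤ-homo-* : ∀ a b → ℚ.fromℤ (a ℤ.* b) ≡ ℚ.fromℤ a ℚ.* ℚ.fromℤ b
fromℤ-homo-* a b = ℚ.toℚᵘ-injective (ℚᵘ.≃-trans (ℚᵘ.*≡* refl)
  (ℚᵘ.≃-sym (ℚ.toℚᵘ-homo-* (ℚ.fromℤ a) (ℚ.fromℤ b))))

fromℤ-homo-neg : ∀ a → ℚ.fromℤ (ℤ.- a) ≡ ℚ.- ℚ.fromℤ a
fromℤ-homo-neg (ℤ.+ 0)       = refl
fromℤ-homo-neg ℤ.+[1+ n ]    = refl
fromℤ-homo-neg (ℤ.-[1+ n ])  = refl

fromℤ-homo-sub : ∀ a b → ℚ.fromℤ (a ℤ.- b) ≡ ℚ.fromℤ a ℚ.- ℚ.fromℤ b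
fromℤ-homo-sub a b = trans (fromℤ-homo-+ a (ℤ.- b)) (cong (ℚ.fromℤ a ℚ.+_) (fromℤ-homo-neg b))

fromℤ-mono-< : ∀ {a b} → a ℤ.< b → ℚ.fromℤ a ℚ.< ℚ.fromℤ b
fromℤ-mono-< {a} {b} a<b = ℚ.*<* (ℤ.*-monoʳ-<-pos ℤ.1ℤ a<b)

fromℤ-mono-≤ : ∀ {a b} → a ℤ.≤ b → ℚ.fromℤ a ℚ.≤ ℚ.fromℤ b
fromℤ-mono-≤ {a} {b} a≤b = ℚ.*≤* (ℤ.*-monoʳ-≤-nonNeg ℤ.1ℤ a≤b)

≗⇒≃ : ∀ {x y} → seq x ≗ seq y → x ≃ y
≗⇒≃ {x} {y} eq ε 0<ε = 0 , λ n _ → subst (ℚ._< ε)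
  (cong ℚ.∣_∣ (sym (trans (cong (ℚ._- seq y n) (eq n)) (ℚ.+-inverseʳ (seq y n))))) 0<ε

≋-refl : ∀ {n} (v : Vector ℝ n) → v ≋ v
≋-refl v i = ≗⇒≃ {v i} {v i} λ _ → refl

∈-lattice : ∀ {m n} (M : Matrix ℝ m n) z → lattice M (M *ᵥ map fromℤ z)
∈-lattice M z = z , ≋-refl (M *ᵥ map fromℤ z)

∈-image : ∀ {m n} (M : Matrix ℝ m n) {P : Pred (Vector ℝ n) 0ℓ} {w} → P w → image M P (M *ᵥ w)
∈-image M {w = w} Pw = w , Pw , ≋-refl (M *ᵥ w)

≃-trans : ∀ {x y z} → x ≃ y → y ≃ z → x ≃ z
≃-trans {x} {y} {z} x≃y y≃z ε 0<ε =
  let M , f = x≃y (½ ℚ.* ε) (half-pos 0<ε)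
      N , g = y≃z (½ ℚ.* ε) (half-pos 0<ε)
  in M ℕ.⊔ N , λ n ≤n → subst (λ a → ℚ.∣ a ∣ ℚ.< ε) (eq (seq x n) (seq y n) (seq z n))
    (∣a+b∣<ε (seq x n ℚ.- seq y n) (seq y n ℚ.- seq z n)
      (f n (ℕ.m⊔n≤o⇒m≤o M N ≤n)) (g n (ℕ.m⊔n≤o⇒n≤o M N ≤n)))
  where
  open +-*-Solver
  eq : ∀ a b c → (a ℚ.- b) ℚ.+ (b ℚ.- c) ≡ a ℚ.- c
  eq = solve 3 (λ a b c → (a :- b) :+ (b :- c) := a :- c) refl

+-cong : ∀ {x y u v} → x ≃ y → u ≃ v → (x + u) ≃ (y + v)
+-cong {x} {y} {u} {v} x≃y u≃v ε 0<ε =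
  let M , f = x≃y (½ ℚ.* ε) (half-pos 0<ε)
      N , g = u≃v (½ ℚ.* ε) (half-pos 0<ε)
  in M ℕ.⊔ N , λ n ≤n → subst (λ a → ℚ.∣ a ∣ ℚ.< ε) (eq (seq x n) (seq y n) (seq u n) (seq v n))
    (∣a+b∣<ε (seq x n ℚ.- seq y n) (seq u n ℚ.- seq v n)
      (f n (ℕ.m⊔n≤o⇒m≤o M N ≤n)) (g n (ℕ.m⊔n≤o⇒n≤o M N ≤n)))
  where
  open +-*-Solver
  eq : ∀ a b c d → (a ℚ.- b) ℚ.+ (c ℚ.- d) ≡ (a ℚ.+ c) ℚ.- (b ℚ.+ d)
  eq = solve 4 (λ a b c d → (a :- b) :+ (c :- d) := (a :+ c) :- (b :+ d)) refl

*-congˡ : ∀ x {y z} → y ≃ z → (x * y) ≃ (x * z)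
*-congˡ x {y} {z} y≃z ε 0<ε =
  let B , 0<B , M , x<B = cauchy⇒bounded {seq x} (cauchy x)
      η , 0<η , Bη = bounded*small B 0<B ε 0<ε
      N , f = y≃z η 0<η
  in M ℕ.⊔ N , λ n ≤n → subst (λ a → ℚ.∣ a ∣ ℚ.< ε) (eq (seq x n) (seq y n) (seq z n))
    (Bη (seq x n) (seq y n ℚ.- seq z n)
      (x<B n (ℕ.m⊔n≤o⇒m≤o M N ≤n)) (f n (ℕ.m⊔n≤o⇒n≤o M N ≤n)))
  where
  open +-*-Solver
  eq : ∀ a b c → a ℚ.* (b ℚ.- c) ≡ a ℚ.* b ℚ.- a ℚ.* c
  eq = solve 3 (λ a b c → a :* (b :- c) := a :* b :- a :* c) refl

sum-cong : ∀ {n} {f g : Vector ℝ n} → f ≋ g → sum +-rawMonoid f ≃ sum +-rawMonoid g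
sum-cong {0}     f≋g = ≗⇒≃ {0ℝ} {0ℝ} λ _ → refl
sum-cong {suc n} {f} {g} f≋g = +-cong {f zero} {g zero}
  {sum +-rawMonoid λ i → f (suc i)} {sum +-rawMonoid λ i → g (suc i)}
  (f≋g zero) (sum-cong λ i → f≋g (suc i))

*ᵥ-cong : ∀ {m n} (M : Matrix ℝ m n) {v w : Vector ℝ n} → v ≋ w → M *ᵥ v ≋ M *ᵥ w
*ᵥ-cong M {v} {w} v≋w i = sum-cong λ j → *-congˡ (M i j) {v j} {w j} (v≋w j)

e≡δ : ∀ {n} (i j : Fin n) → e i j ≡ fromℤ (δ i j)
e≡δ i j with i Fin.≟ j
... | yes _ = refl
... | no  _ = refl

Null : (ℕ → ℚ) → Set
Null f = ∀ ε → 0ℚ ℚ.< ε → Eventually λ n → ℚ.∣ f n ∣ ℚ.< ε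

null⇒≱ : ∀ {f} → Null f → ∀ ε → 0ℚ ℚ.< ε → ¬ Eventually (λ n → ε ℚ.≤ f n)
null⇒≱ {f} null ε 0<ε (M , f≥ε) =
  let N , f<ε = null ε 0<ε
      fk≥ε = f≥ε (M ℕ.⊔ N) (ℕ.m≤m⊔n M N)
      ∣fk∣≡fk = ℚ.0≤p⇒∣p∣≡p (ℚ.≤-trans (ℚ.<⇒≤ 0<ε) fk≥ε)
  in ℚ.<-irrefl refl (ℚ.≤-<-trans fk≥ε (subst (ℚ._< ε) ∣fk∣≡fk (f<ε (M ℕ.⊔ N) (ℕ.m≤n⊔m M N))))

-- Real numbers of the form q a - p b with integers a and b.

module Combinations (p q : ℝ) where

  combination : ℤ → ℤ → ℕ → ℚ
  combination a b n = seq q n ℚ.* ℚ.fromℤ a ℚ.- seq p n ℚ.* ℚ.fromℤ b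

  -- The identity holds term by term, not only in the limit. All coordinates of A z and S A z have
  -- this form, so integer pairs (a, b) can stand in for them.
  record Comb (r : ℕ → ℚ) (a b : ℤ) : Set where
    field
      at : ∀ n → r n ≡ combination a b n

  open Comb

  comb-sum : ∀ {n} (f : Vector ℝ n) {a b : Vector ℤ n} → (∀ j → Comb (seq (f j)) (a j) (b j)) →
    Comb (seq (sum +-rawMonoid f)) (sum ℤ.+-0-rawMonoid a) (sum ℤ.+-0-rawMonoid b)
  comb-sum {0}     f         h .at n =
    solve 2 (λ q p → con 0ℚ := q :* con 0ℚ :- p :* con 0ℚ) refl (seq q n) (seq p n)
    where open +-*-Solver
  comb-sum {suc _} f {a} {b} h .at n = trans
    (cong₂ ℚ._+_ (h zero .at n) (comb-sum (λ j → f (suc j)) (λ j → h (suc j)) .at n))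
    (trans (eq (seq q n) (seq p n) _ _ _ _)
      (sym (cong₂ (λ s t → seq q n ℚ.* s ℚ.- seq p n ℚ.* t)
        (fromℤ-homo-+ (a zero) _) (fromℤ-homo-+ (b zero) _))))
    where
    open +-*-Solver
    eq : ∀ q p a b c d → (q ℚ.* a ℚ.- p ℚ.* b) ℚ.+ (q ℚ.* c ℚ.- p ℚ.* d) ≡
      q ℚ.* (a ℚ.+ c) ℚ.- p ℚ.* (b ℚ.+ d)
    eq = solve 6 (λ q p a b c d →
      (q :* a :- p :* b) :+ (q :* c :- p :* d) := q :* (a :+ c) :- p :* (b :+ d)) refl

  -- Kept generic in n: at a successor dimension the sum in _*ᵥ_ would unfold.
  comb-*ᵥ : ∀ {m n} (M : Matrix ℝ m n) (v : Vector ℝ n) i {a b : Vector ℤ n} →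
    (∀ j → Comb (seq (M i j * v j)) (a j) (b j)) →
    Comb (seq ((M *ᵥ v) i)) (sum ℤ.+-0-rawMonoid a) (sum ℤ.+-0-rawMonoid b)
  comb-*ᵥ M v i = comb-sum (λ j → M i j * v j)

  comb-*ʳ : ∀ r {a b} z → Comb r a b → Comb (λ n → r n ℚ.* ℚ.fromℤ z) (a ℤ.* z) (b ℤ.* z)
  comb-*ʳ r {a} {b} z h .at n = trans (cong (ℚ._* ℚ.fromℤ z) (h .at n))
    (trans (eq (seq q n) (seq p n) _ _ _)
      (sym (cong₂ (λ s t → seq q n ℚ.* s ℚ.- seq p n ℚ.* t) (fromℤ-homo-* a z) (fromℤ-homo-* b z))))
    where
    open +-*-Solver
    eq : ∀ q p a b z → (q ℚ.* a ℚ.- p ℚ.* b) ℚ.* z ≡ q ℚ.* (a ℚ.* z) ℚ.- p ℚ.* (b ℚ.* z)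
    eq = solve 5 (λ q p a b z → (q :* a :- p :* b) :* z := q :* (a :* z) :- p :* (b :* z)) refl

  comb-*ˡ : ∀ z r {a b} → Comb r a b → Comb (λ n → ℚ.fromℤ z ℚ.* r n) (z ℤ.* a) (z ℤ.* b)
  comb-*ˡ z r {a} {b} h .at n = trans (ℚ.*-comm (ℚ.fromℤ z) (r n))
    (trans (comb-*ʳ r z h .at n)
      (cong₂ (λ s t → seq q n ℚ.* ℚ.fromℤ s ℚ.- seq p n ℚ.* ℚ.fromℤ t) (ℤ.*-comm a z) (ℤ.*-comm b z)))

  -- This is A = q I - p R: row i of R is the transposed shift of the i-th unit vector.
  comb-A : ∀ {m} (i k : Fin (suc m)) → Comb (seq (A p q i k)) (δ k i) (unrot (λ j → δ j i) k)
  comb-A {m} i k .at n with view k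
  ... | ‵inject₁ j rewrite e≡δ (inject₁ j) i | e≡δ (suc j) i = refl
  -- The plus sign in the last column is p times minus the sign flip of the shift.
  ... | ‵fromℕ rewrite e≡δ (fromℕ m) i | e≡δ zero i | fromℤ-homo-neg (δ zero i) =
    solve 4 (λ q a p b → q :* a :+ p :* b := q :* a :- p :* (:- b)) refl (seq q n) _ (seq p n) _
    where open +-*-Solver

  comb-A*ᵥ : ∀ {m} (z : Vector ℤ (suc m)) i → Comb (seq ((A p q *ᵥ map fromℤ z) i)) (z i) (rot z i)
  comb-A*ᵥ z i = subst₂ (Comb (seq ((A p q *ᵥ map fromℤ z) i)))
    (δ-· z i) (trans (sym (·-rot (λ j → δ j i) z)) (δ-· (rot z) i))
    (comb-*ᵥ (A p q) (map fromℤ z) i λ k → comb-*ʳ (seq (A p q i k)) (z k) (comb-A i k))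

  comb-ℤ*ᵥ : ∀ {m n} (S : Matrix ℤ m n) {w : Vector ℝ n} {a b : Vector ℤ n} →
    (∀ j → Comb (seq (w j)) (a j) (b j)) → ∀ i → Comb (seq ((fromℤᵐ S *ᵥ w) i)) (S i · a) (S i · b)
  comb-ℤ*ᵥ S {w} h i = comb-*ᵥ (fromℤᵐ S) w i λ j → comb-*ˡ (S i j) (seq (w j)) (h j)

  comb-unique : ∀ {r s a b} → Comb (seq r) a b → Comb (seq s) a b → r ≃ s
  comb-unique {r} {s} h k = ≗⇒≃ {r} {s} λ n → trans (h .at n) (sym (k .at n))

  null-neg : ∀ {a b} → Null (combination a b) → Null (combination (ℤ.- a) (ℤ.- b))
  null-neg {a} {b} null ε 0<ε = let N , h = null ε 0<ε in N , λ n N≤n → subst (ℚ._< ε) (eq n) (h n N≤n)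
    where
    open +-*-Solver
    eq : ∀ n → ℚ.∣ combination a b n ∣ ≡ ℚ.∣ combination (ℤ.- a) (ℤ.- b) n ∣
    eq n rewrite fromℤ-homo-neg a | fromℤ-homo-neg b = trans (sym (ℚ.∣-p∣≡∣p∣ _))
      (cong ℚ.∣_∣ (solve 4 (λ q a p b → :- (q :* a :- p :* b) := q :* (:- a) :- p :* (:- b)) refl
        (seq q n) (ℚ.fromℤ a) (seq p n) (ℚ.fromℤ b)))

  -- Integer consequences of q a = p b.

  module _ (0<p : 0ℝ < p) (p<q : p < q) where

    -- If b ≤ a, then eventually q a - p b ≥ (p + ε) a - p a = ε a > 0, where ε is the gap between p
    -- and q; a null sequence cannot stay above that.
    null-pos : ∀ {a b} → Null (combination a b) → 0ℤ ℤ.< a → a ℤ.< b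
    null-pos {a} {b} null 0<a with b ℤ.≤? a
    ... | no  b≰a = ℤ.≰⇒> b≰a
    ... | yes b≤a =
      let δ₁ , 0<δ₁ , M , δ₁<p = 0<p
          ε₁ , 0<ε₁ , N , ε₁<q = p<q
          instance
            a-pos : ℚ.Positive (ℚ.fromℤ a)
            a-pos = ℚ.positive (fromℤ-mono-< 0<a)
            a-nonNeg : ℚ.NonNegative (ℚ.fromℤ a)
            a-nonNeg = ℚ.pos⇒nonNeg (ℚ.fromℤ a)
      in contradiction
        (M ℕ.⊔ N , λ n ≤n →
          let 0≤p = ℚ.<⇒≤ (ℚ.<-trans 0<δ₁
                (subst (ℚ._< seq p n) (ℚ.+-identityˡ δ₁) (δ₁<p n (ℕ.m⊔n≤o⇒m≤o M N ≤n))))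
          in bound (seq q n) (seq p n) ε₁ (ℚ.fromℤ a) (ℚ.fromℤ b) 0≤p
               (ℚ.<⇒≤ (ε₁<q n (ℕ.m⊔n≤o⇒n≤o M N ≤n))) (fromℤ-mono-≤ b≤a))
        (null⇒≱ null (ε₁ ℚ.* ℚ.fromℤ a)
          (subst (ℚ._< ε₁ ℚ.* ℚ.fromℤ a) (ℚ.*-zeroˡ (ℚ.fromℤ a)) (ℚ.*-monoˡ-<-pos (ℚ.fromℤ a) 0<ε₁)))
      where
      bound : ∀ q p ε a b .{{_ : ℚ.NonNegative a}} → 0ℚ ℚ.≤ p → p ℚ.+ ε ℚ.≤ q → b ℚ.≤ a →
        ε ℚ.* a ℚ.≤ q ℚ.* a ℚ.- p ℚ.* b
      bound q p ε a b 0≤p p+ε≤q b≤a = subst (ℚ._≤ q ℚ.* a ℚ.- p ℚ.* b)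
        (solve 3 (λ p ε a → (p :+ ε) :* a :- p :* a := ε :* a) refl p ε a)
        (ℚ.+-mono-≤ (ℚ.*-monoʳ-≤-nonNeg a p+ε≤q)
          (ℚ.neg-antimono-≤ (ℚ.*-monoˡ-≤-nonNeg p {{ℚ.nonNegative 0≤p}} b≤a)))
        where open +-*-Solver

    -- For negative b the terms - p b are eventually at least a positive lower bound of p times - b.
    null-zero : ∀ {b} → Null (combination 0ℤ b) → b ℤ.≥ 0ℤ
    null-zero {b} null with 0ℤ ℤ.≤? b
    ... | yes 0≤b = 0≤b
    ... | no  0≰b =
      let δ₁ , 0<δ₁ , M , δ₁<p = 0<p
          0<-b : 0ℚ ℚ.< ℚ.- ℚ.fromℤ b
          0<-b = ℚ.neg-antimono-< (fromℤ-mono-< (ℤ.≰⇒> 0≰b))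
          instance
            b-pos : ℚ.Positive (ℚ.- ℚ.fromℤ b)
            b-pos = ℚ.positive 0<-b
            b-nonNeg : ℚ.NonNegative (ℚ.- ℚ.fromℤ b)
            b-nonNeg = ℚ.pos⇒nonNeg (ℚ.- ℚ.fromℤ b)
      in contradiction
        (M , λ n M≤n → subst (δ₁ ℚ.* (ℚ.- ℚ.fromℤ b) ℚ.≤_) (eq (seq q n) (seq p n) (ℚ.fromℤ b))
          (ℚ.*-monoʳ-≤-nonNeg (ℚ.- ℚ.fromℤ b)
            (ℚ.<⇒≤ (subst (ℚ._< seq p n) (ℚ.+-identityˡ δ₁) (δ₁<p n M≤n)))))
        (null⇒≱ null (δ₁ ℚ.* (ℚ.- ℚ.fromℤ b))
          (subst (ℚ._< δ₁ ℚ.* (ℚ.- ℚ.fromℤ b)) (ℚ.*-zeroˡ (ℚ.- ℚ.fromℤ b))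
            (ℚ.*-monoˡ-<-pos (ℚ.- ℚ.fromℤ b) 0<δ₁)))
      where
      open +-*-Solver
      eq : ∀ q p b → p ℚ.* (ℚ.- b) ≡ q ℚ.* 0ℚ ℚ.- p ℚ.* b
      eq = solve 3 (λ q p b → p :* (:- b) := q :* con 0ℚ :- p :* b) refl

    -- Trichotomy on a. Negating both integers reduces a < 0 to the positive case and, when a = 0,
    -- gives the second inequality for b = 0.
    null⇒◁ : ∀ {a b} → Null (combination a b) → a ◁ b
    null⇒◁ {a} {b} null with ℤ.<-cmp a 0ℤ
    ... | tri> _ _ 0<a = pos 0<a (null-pos null 0<a)
    ... | tri< a<0 _ _ = neg (ℤ.neg-cancel-< (null-pos (null-neg {a} {b} null) (ℤ.neg-mono-< a<0))) a<0
    ... | tri≈ _ refl _ = zer refl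
      (ℤ.≤-antisym (ℤ.neg-cancel-≤ (null-zero (null-neg {a} {b} null))) (null-zero null))

    comb-≃⇒◁ : ∀ {r s a b c d} → Comb (seq r) a b → Comb (seq s) c d → r ≃ s → (a ℤ.- c) ◁ (b ℤ.- d)
    comb-≃⇒◁ {r} {s} {a} {b} {c} {d} h k r≃s = null⇒◁ λ ε 0<ε →
      let N , r-s<ε = r≃s ε 0<ε
      in N , λ n N≤n → subst (λ t → ℚ.∣ t ∣ ℚ.< ε) (eq n) (r-s<ε n N≤n)
      where
      open +-*-Solver
      eq : ∀ n → seq r n ℚ.- seq s n ≡ combination (a ℤ.- c) (b ℤ.- d) n
      eq n rewrite h .at n | k .at n | fromℤ-homo-sub a c | fromℤ-homo-sub b d =
        solve 6 (λ q p a b c d → (q :* a :- p :* b) :- (q :* c :- p :* d) := q :* (a :- c) :- p :* (b :- d)) refl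
          (seq q n) (seq p n) (ℚ.fromℤ a) (ℚ.fromℤ b) (ℚ.fromℤ c) (ℚ.fromℤ d)

-- Invariance of the lattice and commutation with the shift.

module _ {m} (p q : ℝ) {S : Matrix ℤ (suc m) (suc m)} (signed : IsSignedPermutation S) where
  open Combinations p q

  comb-SA : ∀ z i → Comb (seq ((fromℤᵐ S *ᵥ A p q *ᵥ map fromℤ z) i)) (S i · z) (S i · rot z)
  comb-SA z = comb-ℤ*ᵥ S {A p q *ᵥ map fromℤ z} {z} {rot z} (comb-A*ᵥ z)

  invariant⇒rotCommutes : 0ℝ < p → p < q →
    image (fromℤᵐ S) (lattice (A p q)) ⊆ lattice (A p q) → RotCommutes S
  invariant⇒rotCommutes 0<p p<q S⊆ i k =
    let z , SAδ≋Az = S⊆ {fromℤᵐ S *ᵥ A p q *ᵥ map fromℤ (δ k)}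
          (∈-image (fromℤᵐ S) {lattice (A p q)} {A p q *ᵥ map fromℤ (δ k)} (∈-lattice (A p q) (δ k)))
    -- Here x = S eₖ - z, and the signed unit vectors compared are R S eₖ and S R eₖ.
    in signedUnits-agree {x = λ l → S l k ℤ.- z l}
      (rot-signedUnit (column-signedUnit signed k)) (unrotColumn-signedUnit signed k)
      (λ l → subst₂ _◁_
        (cong (ℤ._- z l) (·-δ (S l) k))
        -- S R eₖ - R z is regrouped as R (S eₖ - z) + (S R eₖ - R S eₖ).
        (trans (cong (ℤ._- rot z l) (trans (·-rot (S l) (δ k)) (·-δ (unrot (S l)) k)))
          (trans (regroup (unrot (S l) k) (rot z l) (rot (λ l → S l k) l))
            (cong (ℤ._+ (unrot (S l) k ℤ.- rot (λ l → S l k) l)) (sym (rot-sub (λ l → S l k) z l)))))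
        (comb-≃⇒◁ 0<p p<q {(fromℤᵐ S *ᵥ A p q *ᵥ map fromℤ (δ k)) l} {(A p q *ᵥ map fromℤ z) l}
          (comb-SA (δ k) l) (comb-A*ᵥ z l) (SAδ≋Az l)))
      i
    where
    open ℤ.+-*-Solver
    regroup : ∀ v z u → v ℤ.- z ≡ (u ℤ.- z) ℤ.+ (v ℤ.- u)
    regroup = solve 3 (λ v z u → v :- z := (u :- z) :+ (v :- u)) refl

  rotCommutes⇒invariant : RotCommutes S → image (fromℤᵐ S) (lattice (A p q)) ≐ lattice (A p q)
  rotCommutes⇒invariant comm = (λ {v} → S⊆ {v}) , (λ {v} → ⊆S {v})
    where
    S·_ : Vector ℤ (suc m) → Vector ℤ (suc m)
    (S· z) i = S i · z

    -- The pair (S z, R S z) is also the one belonging to A (S z), so S A z = A S z.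
    comb-SA′ : ∀ z i → Comb (seq ((fromℤᵐ S *ᵥ A p q *ᵥ map fromℤ z) i)) (S i · z) (rot (S· z) i)
    comb-SA′ z i = subst (Comb (seq ((fromℤᵐ S *ᵥ A p q *ᵥ map fromℤ z) i)) (S i · z))
      (rotCommutes-· comm z i) (comb-SA z i)

    S⊆ : image (fromℤᵐ S) (lattice (A p q)) ⊆ lattice (A p q)
    S⊆ {v} (w , (z , w≋Az) , v≋Sw) = S· z , λ i →
      ≃-trans {v i} {(fromℤᵐ S *ᵥ w) i} {(A p q *ᵥ map fromℤ (S· z)) i} (v≋Sw i)
        (≃-trans {(fromℤᵐ S *ᵥ w) i} {(fromℤᵐ S *ᵥ A p q *ᵥ map fromℤ z) i} {(A p q *ᵥ map fromℤ (S· z)) i}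
          (*ᵥ-cong (fromℤᵐ S) {w} {A p q *ᵥ map fromℤ z} w≋Az i)
          (comb-unique {(fromℤᵐ S *ᵥ A p q *ᵥ map fromℤ z) i} {(A p q *ᵥ map fromℤ (S· z)) i}
            (comb-SA′ z i) (comb-A*ᵥ (S· z) i)))

    ⊆S : lattice (A p q) ⊆ image (fromℤᵐ S) (lattice (A p q))
    -- With S z′ = z, the lattice point A z′ is sent to S A z′ = A S z′ = A z.
    ⊆S {v} (z , v≋Az) = A p q *ᵥ map fromℤ z′ , ∈-lattice (A p q) z′ , λ i →
      ≃-trans {v i} {(A p q *ᵥ map fromℤ z) i} {(fromℤᵐ S *ᵥ A p q *ᵥ map fromℤ z′) i} (v≋Az i)
        (comb-unique {(A p q *ᵥ map fromℤ z) i} {(fromℤᵐ S *ᵥ A p q *ᵥ map fromℤ z′) i} (comb-A*ᵥ z i)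
          (subst₂ (Comb (seq ((fromℤᵐ S *ᵥ A p q *ᵥ map fromℤ z′) i)))
            (·-preimage signed z i) (rot-cong (·-preimage signed z) i) (comb-SA′ z′ i)))
      where
      z′ : Vector ℤ (suc m)
      z′ = preimage signed z

theorem3 : (m : ℕ) → 2 ≤ suc m →
    (p q : ℝ) → 0ℝ < p → p < q →
    (S : Matrix ℤ (suc m) (suc m)) → IsSignedPermutation S →
    (image (fromℤᵐ S) (lattice (A p q)) ≐ lattice (A p q))
    ⇔
    ( (∀ (i j : Fin m) → S (inject₁ i) (inject₁ j) ≡ S (suc i) (suc j))
    × (∀ (i : Fin m) → S (inject₁ i) (fromℕ m) ≡ ℤ.- S (suc i) zero)
    × (∀ (j : Fin m) → S (fromℕ m) (inject₁ j) ≡ ℤ.- S zero (suc j))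
    × S (fromℕ m) (fromℕ m) ≡ S zero zero)
theorem3 m _ p q 0<p p<q S signed = mk⇔
  (λ (S⊆ , _) → rotCommutes⇒negacyclic (invariant⇒rotCommutes p q signed 0<p p<q λ {v} → S⊆ {v}))
  (λ nc → rotCommutes⇒invariant p q signed (negacyclic⇒rotCommutes nc))
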